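{- Let $\Gamma$ be a finite connected tetravalent graph and let $G\le \mathrm{Aut}(\Gamma)$ be such that $\Gamma$ is $(G,\frac12)$-arc-transitive. If $G$ contains an abelian normal subgroup $N$ such that $N_v\neq 1$ for some vertex $v$ of $\Gamma$, then $G$ is solvable and the vertex-stabiliser $G_v$ is elementary abelian.
   Context: A graph is a quadruple $(D,V;\mathrm{beg},\mathrm{inv})$ where $D$ (darts) and $V\neq\emptyset$ (vertices) are disjoint finite sets, $\mathrm{beg}\colon D\to V$ assigns to each dart its initial vertex, and $\mathrm{inv}\colon D\to D$ is an involution (possibly with fixed points). Edges are the orbits of $\mathrm{inv}$ (so loops, parallel edges and semiedges, i.e. darts fixed by $\mathrm{inv}$, are allowed). The valence of a vertex $v$ is the number of darts $x$ with $\mathrm{beg}(x)=v$; tetravalent means all vertices have valence $4$. An automorphism is a bijection of $V\cup D$ mapping $V$ to $V$, $D$ to $D$, and commuting with $\mathrm{beg}$ and $\mathrm{inv}$. For $G\le\mathrm{Aut}(\Gamma)$, the connected graph $\Gamma$ is $(G,\frac12)$-arc-transitive if $G$ acts transitively on the vertices and on the edges of $\Gamma$ but not on its darts. $N_v$ denotes the stabiliser of $v$ in $N$. -}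

module Defs where

open import Data.Nat using (ℕ; zero; suc)
open import Data.Nat.Primality using (Prime)
open import Data.Fin using (Fin; _≟_; fromℕ; inject₁)
import Data.Fin as F
open import Data.List using (List; length; filter)
open import Data.Fin.Base using ()
open import Data.List using ()
import Data.Fin.Properties
open import Data.Product using (Σ; ∃; ∃-syntax; _×_; _,_)
open import Data.Sum using (_⊎_)
open import Relation.Nullary using (¬_)
open import Relation.Binary.PropositionalEquality using (_≡_; refl; sym; trans; cong)

-- Graphs in the dart formalism: D = Fin d (darts), V = Fin n (vertices).
-- V ≠ ∅ is imposed in the theorem by taking n = suc m.

record Graph (d n : ℕ) : Set where
  field
    beg       : Fin d → Fin n
    inv       : Fin d → Fin d
    inv-invol : ∀ x → inv (inv x) ≡ x
open Graph public

valence : ∀ {d n} → Graph d n → Fin n → ℕ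
valence {d} Γ v = length (filter (λ x → beg Γ x ≟ v) (Data.List.tabulate {n = d} (λ x → x)))
  where import Data.List

Tetravalent : ∀ {d n} → Graph d n → Set
Tetravalent Γ = ∀ v → valence Γ v ≡ 4

data Walk {d n} (Γ : Graph d n) : Fin n → Fin n → Set where
  here : ∀ {u} → Walk Γ u u
  step : ∀ {u v} (x : Fin d) → beg Γ x ≡ u → Walk Γ (beg Γ (inv Γ x)) v → Walk Γ u v

Connected : ∀ {d n} → Graph d n → Set
Connected Γ = ∀ u v → Walk Γ u v

record Aut {d n} (Γ : Graph d n) : Set where
  field
    fV  : Fin n → Fin n
    fV⁻ : Fin n → Fin n
    fV-l : ∀ u → fV⁻ (fV u) ≡ u
    fV-r : ∀ u → fV (fV⁻ u) ≡ u
    fD  : Fin d → Fin d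
    fD⁻ : Fin d → Fin d
    fD-l : ∀ x → fD⁻ (fD x) ≡ x
    fD-r : ∀ x → fD (fD⁻ x) ≡ x
    beg-comm : ∀ x → beg Γ (fD x) ≡ fV (beg Γ x)
    inv-comm : ∀ x → inv Γ (fD x) ≡ fD (inv Γ x)
open Aut public

module _ {d n} {Γ : Graph d n} where

  _≈_ : Aut Γ → Aut Γ → Set
  g ≈ h = (∀ u → fV g u ≡ fV h u) × (∀ x → fD g x ≡ fD h x)

  idA : Aut Γ
  idA = record
    { fV = λ u → u ; fV⁻ = λ u → u ; fV-l = λ _ → refl ; fV-r = λ _ → refl
    ; fD = λ x → x ; fD⁻ = λ x → x ; fD-l = λ _ → refl ; fD-r = λ _ → refl
    ; beg-comm = λ _ → refl ; inv-comm = λ _ → refl }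

  _∘A_ : Aut Γ → Aut Γ → Aut Γ
  g ∘A h = record
    { fV = λ u → fV g (fV h u)
    ; fV⁻ = λ u → fV⁻ h (fV⁻ g u)
    ; fV-l = λ u → trans (cong (fV⁻ h) (fV-l g (fV h u))) (fV-l h u)
    ; fV-r = λ u → trans (cong (fV g) (fV-r h (fV⁻ g u))) (fV-r g u)
    ; fD = λ x → fD g (fD h x)
    ; fD⁻ = λ x → fD⁻ h (fD⁻ g x)
    ; fD-l = λ x → trans (cong (fD⁻ h) (fD-l g (fD h x))) (fD-l h x)
    ; fD-r = λ x → trans (cong (fD g) (fD-r h (fD⁻ g x))) (fD-r g x)
    ; beg-comm = λ x → trans (beg-comm g (fD h x)) (cong (fV g) (beg-comm h x))
    ; inv-comm = λ x → trans (inv-comm g (fD h x)) (cong (fD g) (inv-comm h x)) }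

  _⁻¹A : Aut Γ → Aut Γ
  g ⁻¹A = record
    { fV = fV⁻ g ; fV⁻ = fV g ; fV-l = fV-r g ; fV-r = fV-l g
    ; fD = fD⁻ g ; fD⁻ = fD g ; fD-l = fD-r g ; fD-r = fD-l g
    ; beg-comm = λ x → trans (sym (fV-l g (beg Γ (fD⁻ g x))))
                             (cong (fV⁻ g) (trans (sym (beg-comm g (fD⁻ g x)))
                                                  (cong (beg Γ) (fD-r g x))))
    ; inv-comm = λ x → trans (sym (fD-l g (inv Γ (fD⁻ g x))))
                             (cong (fD⁻ g) (trans (sym (inv-comm g (fD⁻ g x)))
                                                  (cong (inv Γ) (fD-r g x)))) }

  _^A_ : Aut Γ → ℕ → Aut Γ
  g ^A zero = idA
  g ^A suc k = g ∘A (g ^A k)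

  comm : Aut Γ → Aut Γ → Aut Γ
  comm g h = (g ⁻¹A) ∘A ((h ⁻¹A) ∘A (g ∘A h))

record Subgroup {d n} (Γ : Graph d n) : Set₁ where
  field
    _∈_   : Aut Γ → Set
    ∈-resp : ∀ {g h} → g ≈ h → _∈_ g → _∈_ h
    id∈   : _∈_ idA
    ∘∈    : ∀ {g h} → _∈_ g → _∈_ h → _∈_ (g ∘A h)
    ⁻¹∈   : ∀ {g} → _∈_ g → _∈_ (g ⁻¹A)
open Subgroup public

module _ {d n} {Γ : Graph d n} where

  _≤G_ : Subgroup Γ → Subgroup Γ → Set
  H ≤G K = ∀ g → _∈_ H g → _∈_ K g

  -- H is normal in K (H ≤ K assumed separately)
  _⊴_ : Subgroup Γ → Subgroup Γ → Set
  H ⊴ K = ∀ g h → _∈_ K g → _∈_ H h → _∈_ H ((g ⁻¹A) ∘A (h ∘A g))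

  AbelianSet : (Aut Γ → Set) → Set
  AbelianSet P = ∀ g h → P g → P h → (g ∘A h) ≈ (h ∘A g)

  Abelian : Subgroup Γ → Set
  Abelian H = AbelianSet (_∈_ H)

  -- solvable: a subnormal series H = S₀ ⊵ S₁ ⊵ … ⊵ Sₖ = 1 with abelian
  -- factors (commutators of Sᵢ lie in Sᵢ₊₁)
  Solvable : Subgroup Γ → Set₁
  Solvable H = Σ ℕ λ k → Σ (Fin (suc k) → Subgroup Γ) λ S →
      (∀ g → (_∈_ (S F.zero) g → _∈_ H g) × (_∈_ H g → _∈_ (S F.zero) g))
    × (∀ g → _∈_ (S (fromℕ k)) g → g ≈ idA)
    × (∀ (i : Fin k) → (S (F.suc i) ≤G S (inject₁ i))
                     × (S (F.suc i) ⊴ S (inject₁ i))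
                     × (∀ g h → _∈_ (S (inject₁ i)) g → _∈_ (S (inject₁ i)) h
                              → _∈_ (S (F.suc i)) (comm g h)))

  stab : Subgroup Γ → Fin n → Aut Γ → Set
  stab H v g = _∈_ H g × (fV g v ≡ v)

  ElementaryAbelian : (Aut Γ → Set) → Set
  ElementaryAbelian P = AbelianSet P × ∃[ p ] (Prime p × (∀ g → P g → (g ^A p) ≈ idA))

  VertexTransitive : Subgroup Γ → Set
  VertexTransitive G = ∀ u v → ∃[ g ] (_∈_ G g × fV g u ≡ v)

  -- edges are inv-orbits {x, inv x}
  EdgeTransitive : Subgroup Γ → Set
  EdgeTransitive G = ∀ x y → ∃[ g ] (_∈_ G g × (fD g x ≡ y ⊎ fD g x ≡ inv Γ y))

  DartTransitive : Subgroup Γ → Set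
  DartTransitive G = ∀ x y → ∃[ g ] (_∈_ G g × fD g x ≡ y)

  HalfArcTransitive : Subgroup Γ → Set
  HalfArcTransitive G = VertexTransitive G × EdgeTransitive G × ¬ DartTransitive G

{-# OPTIONS --safe #-}
module Submission where

-- G has two orbits on darts, and each vertex is the origin of two darts of each orbit.
-- Among the elements of N that fix a vertex, take a nontrivial n moving the fewest
-- darts. Let K be the kernel of G on the N-orbits. Both n² and k⁻¹nk · n, for k in K,
-- fix a vertex and more darts than n, so they are trivial: n is an involution
-- centralised by K. Let M be the group of the elements of N of square 1 centralised by
-- K. As n swaps two darts of a G-orbit at a vertex, the map sending a vertex to the
-- head of such a dart induces a permutation of the M-orbits that commutes with G and
-- is transitive; hence the kernel L of G on the M-orbits contains [G, G] and all
-- vertex stabilisers. For g in L and a vertex w, write g = m h with m in M and h in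
-- G_w; then g² = h² fixes every dart at w. So L has exponent 2, and G ⊵ L ⊵ 1.

open import Defs
open import Algebra.Properties.CommutativeMonoid.Sum using (sum; sum-cong-≗; sum-permute; ∑-comm; ∑-distrib-+)
open import Data.Bool using (Bool; true; false; not; _∧_)
import Data.Bool.Properties as Bool
open import Data.Empty using (⊥; ⊥-elim)
open import Data.Fin using (Fin; zero; suc; toℕ; inject₁; _≟_)
open import Data.Fin.Permutation using (permutation)
open import Data.Fin.Properties using (pigeonhole)
open import Data.List using (length; filter; tabulate)
open import Data.Nat using (ℕ; zero; suc; _+_; _*_; _≤_; _<_; z≤n; s≤s)
open import Data.Nat.Induction using (<-wellFounded)
open import Data.Nat.Primality using (prime[2])
open import Data.Nat.Properties using (+-0-commutativeMonoid; +-identityʳ; +-mono-≤; +-mono-≤-<; +-comm; +-suc; *-cancelˡ-≡; *-zeroʳ; ≤-refl; ≤-trans; m≤n⇒∃[o]m+o≡n; n<1+n)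
open import Data.Product using (∃-syntax; _×_; _,_; proj₁; proj₂)
open import Data.Sum using (_⊎_; inj₁; inj₂)
open import Function using (_∘_; mk⇔)
open import Induction.WellFounded using (Acc; acc)
open import Relation.Binary.PropositionalEquality using (_≡_; _≢_; refl; sym; trans; cong; cong₂; subst; module ≡-Reasoning)
open import Relation.Nullary using (¬_; Dec; yes; no; does; contradiction)
open import Relation.Nullary.Decidable using (dec-true; dec-false; does-⇔; decidable-stable)
open import Relation.Unary using (Decidable)

-- Counting on finite sets, and minimal elements.

private
  ∑ : ∀ {n} → (Fin n → ℕ) → ℕ
  ∑ = sum +-0-commutativeMonoid

indicator : Bool → ℕ
indicator false = 0
indicator true  = 1

count : ∀ {n} → (Fin n → Bool) → ℕ
count p = ∑ (indicator ∘ p)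

length-filter-tabulate : ∀ {n} {A : Set} {P : A → Set} (P? : Decidable P) (f : Fin n → A) →
  length (filter P? (tabulate f)) ≡ count (does ∘ P? ∘ f)
length-filter-tabulate {zero}  P? f = refl
length-filter-tabulate {suc n} P? f with does (P? (f zero))
... | true  = cong suc (length-filter-tabulate P? (f ∘ suc))
... | false = length-filter-tabulate P? (f ∘ suc)

∑-const : ∀ n c → ∑ {n} (λ _ → c) ≡ n * c
∑-const zero    c = refl
∑-const (suc n) c = cong (c +_) (∑-const n c)

count-∧-≟ : ∀ {n} c (w : Fin n) → count (λ v → c ∧ does (w ≟ v)) ≡ indicator c
count-∧-≟ {n} false w = trans (∑-const n 0) (*-zeroʳ n)
count-∧-≟ {suc n} true zero    = cong suc (trans (∑-const n 0) (*-zeroʳ n))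
count-∧-≟ {suc n} true (suc w) = count-∧-≟ true w

indicator-mono : ∀ {a b} → (a ≡ true → b ≡ true) → indicator a ≤ indicator b
indicator-mono {false} _ = z≤n
indicator-mono {true}  h rewrite h refl = ≤-refl

count-mono : ∀ {n} {p q : Fin n → Bool} → (∀ i → p i ≡ true → q i ≡ true) → count p ≤ count q
count-mono {zero}  h = z≤n
count-mono {suc n} h = +-mono-≤ (indicator-mono (h zero)) (count-mono (h ∘ suc))

count-mono-< : ∀ {n} {p q : Fin n → Bool} → (∀ i → p i ≡ true → q i ≡ true) →
  ∀ x → p x ≡ false → q x ≡ true → count p < count q
count-mono-< h zero    px qx rewrite px | qx = s≤s (count-mono (h ∘ suc))
count-mono-< h (suc x) px qx = +-mono-≤-< (indicator-mono (h zero)) (count-mono-< (h ∘ suc) x px qx)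

_∖_ : ∀ {n} → (Fin n → Bool) → Fin n → (Fin n → Bool)
(p ∖ a) i = p i ∧ not (does (i ≟ a))

count-∖ : ∀ {n} {p : Fin n → Bool} a → p a ≡ true → count (p ∖ a) < count p
count-∖ {p = p} a pa = count-mono-< (λ i → ∧-trueˡ) a
  (cong₂ (λ b c → b ∧ not c) pa (dec-true (a ≟ a) refl)) pa
  where
  ∧-trueˡ : ∀ {b c} → b ∧ c ≡ true → b ≡ true
  ∧-trueˡ {true} e = refl

∖-true : ∀ {n} {p : Fin n → Bool} {a i} → p i ≡ true → i ≢ a → (p ∖ a) i ≡ true
∖-true {a = a} {i} pi i≢a = cong₂ (λ b c → b ∧ not c) pi (dec-false (i ≟ a) i≢a)

-- Removing three distinct elements one after the other lowers the count three times, so it would be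
-- at least 3.
count≡2⇒pigeonhole : ∀ {n} (p : Fin n → Bool) → count p ≡ 2 →
  ∀ {a b c} → p a ≡ true → p b ≡ true → p c ≡ true → a ≢ b → b ≢ c → a ≡ c
count≡2⇒pigeonhole p p≡2 {a} {b} {c} pa pb pc a≢b b≢c = decidable-stable (a ≟ c) λ a≢c →
  let p-a  = p ∖ a
      p-ab = p-a ∖ b
      b∈   = ∖-true {p = p} pb (a≢b ∘ sym)
      c∈   = ∖-true {p = p-a} (∖-true {p = p} pc (a≢c ∘ sym)) (b≢c ∘ sym)
      3≤p  = ≤-trans (s≤s (≤-trans (s≤s (≤-trans (s≤s z≤n) (count-∖ {p = p-ab} c c∈)))
                                   (count-∖ {p = p-a} b b∈)))
                     (count-∖ {p = p} a pa)
  in contradiction (subst (3 ≤_) p≡2 3≤p) λ { (s≤s (s≤s ())) }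

-- Well-founded descent on the value of `f`. As `P` need not be decidable, the minimum is only
-- obtained up to double negation.
¬¬-minimum : ∀ {A : Set} {P : A → Set} (f : A → ℕ) {a} → P a →
  ¬ ¬ (∃[ a ] (P a × (∀ b → P b → ¬ (f b < f a))))
¬¬-minimum {P = P} f {a} Pa none = descend Pa (<-wellFounded (f a))
  where
  descend : ∀ {a} → P a → Acc _<_ (f a) → ⊥
  descend {a} Pa (acc rs) = none (a , Pa , λ b Pb fb<fa → descend Pb (rs fb<fa))

-- Automorphisms and subgroups.

end : ∀ {d n} → Graph d n → Fin d → Fin n
end Γ x = beg Γ (inv Γ x)

module _ {d n} {Γ : Graph d n} where

  _∋_ : Subgroup Γ → Aut Γ → Set
  H ∋ g = _∈_ H g

  end-comm : ∀ (g : Aut Γ) x → end Γ (fD g x) ≡ fV g (end Γ x)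
  end-comm g x = trans (cong (beg Γ) (inv-comm g x)) (beg-comm g (inv Γ x))

  fD-injective : ∀ (g : Aut Γ) {x y} → fD g x ≡ fD g y → x ≡ y
  fD-injective g {x} {y} e = trans (sym (fD-l g x)) (trans (cong (fD⁻ g) e) (fD-l g y))

  fV-injective : ∀ (g : Aut Γ) {u v} → fV g u ≡ fV g v → u ≡ v
  fV-injective g {u} {v} e = trans (sym (fV-l g u)) (trans (cong (fV⁻ g) e) (fV-l g v))

  fixes-beg : ∀ (g : Aut Γ) {x} → fD g x ≡ x → fV g (beg Γ x) ≡ beg Γ x
  fixes-beg g {x} e = trans (sym (beg-comm g x)) (cong (beg Γ) e)

  fV-^A-+ : ∀ (g : Aut Γ) i j u → fV (g ^A (i + j)) u ≡ fV (g ^A i) (fV (g ^A j) u)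
  fV-^A-+ g zero    j u = refl
  fV-^A-+ g (suc i) j u = cong (fV g) (fV-^A-+ g i j u)

  ^A-∈ : ∀ (H : Subgroup Γ) {g} → H ∋ g → ∀ k → H ∋ (g ^A k)
  ^A-∈ H g∈ zero    = id∈ H
  ^A-∈ H g∈ (suc k) = ∘∈ H g∈ (^A-∈ H g∈ k)

  exponent-2⇒abelian : ∀ (H : Subgroup Γ) → (∀ g → H ∋ g → (g ∘A g) ≈ idA) → Abelian H
  exponent-2⇒abelian H sq g h g∈ h∈ =
    (λ u → swap (fV g) (fV h) (proj₁ (sq g g∈)) (proj₁ (sq h h∈)) (proj₁ (sq (g ∘A h) (∘∈ H g∈ h∈))) u) ,
    (λ x → swap (fD g) (fD h) (proj₂ (sq g g∈)) (proj₂ (sq h h∈)) (proj₂ (sq (g ∘A h) (∘∈ H g∈ h∈))) x)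
    where
    swap : ∀ {A : Set} (f k : A → A) → (∀ a → f (f a) ≡ a) → (∀ a → k (k a) ≡ a) →
      (∀ a → f (k (f (k a))) ≡ a) → ∀ a → f (k a) ≡ k (f a)
    swap f k ff kk fkfk a = trans (sym (kk _)) (cong k (trans (sym (ff _)) (cong f (fkfk a))))

  trivialSubgroup : Subgroup Γ
  trivialSubgroup ._∈_ g = g ≈ idA
  trivialSubgroup .∈-resp (e , f) (e′ , f′) =
    (λ u → trans (sym (e u)) (e′ u)) ,
    (λ x → trans (sym (f x)) (f′ x))
  trivialSubgroup .id∈ = (λ _ → refl) , (λ _ → refl)
  trivialSubgroup .∘∈ {g} (e , f) (e′ , f′) =
    (λ u → trans (cong (fV g) (e′ u)) (e u)) ,
    (λ x → trans (cong (fD g) (f′ x)) (f x))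
  trivialSubgroup .⁻¹∈ {g} (e , f) =
    (λ u → trans (cong (fV⁻ g) (sym (e u))) (fV-l g u)) ,
    (λ x → trans (cong (fD⁻ g) (sym (f x))) (fD-l g x))

  -- Orbits of a subgroup and the kernel of the action on them.

  -- Memberships in a subgroup are undecidable, so orbits are taken up to double
  -- negation: classical reasoning is then available for the decidable conclusions.
  Orb : Subgroup Γ → Fin n → Fin n → Set
  Orb H u v = ¬ ¬ (∃[ h ] (H ∋ h × fV h u ≡ v))

  module _ (H : Subgroup Γ) where

    Orb-reflexive : ∀ {u v} → u ≡ v → Orb H u v
    Orb-reflexive e k = k (idA , id∈ H , e)

    Orb-refl : ∀ {u} → Orb H u u
    Orb-refl = Orb-reflexive refl

    Orb-sym : ∀ {u v} → Orb H u v → Orb H v u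
    Orb-sym o k = o λ { (h , h∈ , refl) → k (h ⁻¹A , ⁻¹∈ H h∈ , fV-l h _) }

    Orb-trans : ∀ {u v w} → Orb H u v → Orb H v w → Orb H u w
    Orb-trans o p k = o λ { (h , h∈ , refl) → p λ { (h′ , h′∈ , refl) → k (h′ ∘A h , ∘∈ H h′∈ h∈ , refl) } }

  module _ (G H : Subgroup Γ) (H≤G : H ≤G G) (H⊴G : H ⊴ G) where

    Orb-map : ∀ {g u v} → G ∋ g → Orb H u v → Orb H (fV g u) (fV g v)
    Orb-map {g} g∈ o k = o λ { (h , h∈ , refl) →
      -- The witness is the conjugate of `h` by the inverse of `g`: it sends `g u` to `g (h u)`.
      k ( _ , H⊴G (g ⁻¹A) h (⁻¹∈ G g∈) h∈ , cong (fV g ∘ fV h) (fV-l g _)) }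

    -- The kernel of the action of G on the set of H-orbits.
    Ker : Subgroup Γ
    Ker ._∈_ g = G ∋ g × (∀ v → Orb H v (fV g v))
    Ker .∈-resp g≈h (g∈ , o) =
      ∈-resp G g≈h g∈ , λ v → Orb-trans H (o v) (Orb-reflexive H (proj₁ g≈h v))
    Ker .id∈ = id∈ G , λ v → Orb-refl H
    Ker .∘∈ {h = h} (g∈ , o) (h∈ , p) = ∘∈ G g∈ h∈ , λ v → Orb-trans H (p v) (o (fV h v))
    Ker .⁻¹∈ {g} (g∈ , o) =
      ⁻¹∈ G g∈ , λ v → Orb-sym H (Orb-trans H (o (fV⁻ g v)) (Orb-reflexive H (fV-r g v)))

    Ker-normal : Ker ⊴ G
    Ker-normal g h g∈ (h∈ , o) =
      ∘∈ G (⁻¹∈ G g∈) (∘∈ G h∈ g∈) ,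
      λ v → Orb-trans H (Orb-reflexive H (sym (fV-l g v))) (Orb-map (⁻¹∈ G g∈) (o (fV g v)))

-- The two orbits of `G` on darts.

-- On an empty set of darts, dart-transitivity would hold vacuously.
dart : ∀ {d m} (Γ : Graph d (suc m)) (G : Subgroup Γ) → ¬ DartTransitive G → Fin d
dart {zero}  Γ G ¬dt = ⊥-elim (¬dt λ ())
dart {suc d} Γ G ¬dt = zero

module HalfTransitive {d m} (Γ : Graph d (suc m)) (tetra : Tetravalent Γ)
  (G : Subgroup Γ) (half : HalfArcTransitive G) where

  private
    vertexTransitive = proj₁ half
    edgeTransitive   = proj₁ (proj₂ half)
    ¬dartTransitive  = proj₂ (proj₂ half)

  x₀ : Fin d
  x₀ = dart Γ G ¬dartTransitive

  Forward : Fin d → Set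
  Forward y = ∃[ g ] (G ∋ g × fD g x₀ ≡ y)

  orient : ∀ y → Forward y ⊎ Forward (inv Γ y)
  orient y with edgeTransitive x₀ y
  ... | g , g∈ , inj₁ e = inj₁ (g , g∈ , e)
  ... | g , g∈ , inj₂ e = inj₂ (g , g∈ , e)

  -- An element reversing one edge would make G transitive on darts.
  forward-exclusive : ∀ {y} → Forward y → ¬ Forward (inv Γ y)
  forward-exclusive (k , k∈ , refl) (l , l∈ , e) = ¬dartTransitive λ a b →
    let (g , g∈ , ga) = forward a
        (h , h∈ , hb) = forward b
    in h ∘A (g ⁻¹A) , ∘∈ G h∈ (⁻¹∈ G g∈) ,
       trans (cong (fD h) (trans (cong (fD⁻ g) (sym ga)) (fD-l g x₀))) hb
    where
    reverse : fD⁻ k (fD l x₀) ≡ inv Γ x₀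
    reverse = trans (cong (fD⁻ k) (trans e (inv-comm k x₀))) (fD-l k (inv Γ x₀))

    forward : ∀ z → Forward z
    forward z with orient z
    ... | inj₁ f = f
    ... | inj₂ (g , g∈ , ge) = g ∘A ((k ⁻¹A) ∘A l) , ∘∈ G g∈ (∘∈ G (⁻¹∈ G k∈) l∈) ,
      trans (cong (fD g) reverse) (trans (sym (inv-comm g x₀)) (trans (cong (inv Γ) ge) (inv-invol Γ z)))

  -- Membership in `G` is undecidable, yet the orbit of a dart can be computed: the witnesses of
  -- edge-transitivity say which end of the edge lies in the orbit of `x₀`.
  dir : Fin d → Bool
  dir y with orient y
  ... | inj₁ _ = true
  ... | inj₂ _ = false

  forward⇒dir : ∀ {y} → Forward y → dir y ≡ true
  forward⇒dir {y} f with orient y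
  ... | inj₁ _  = refl
  ... | inj₂ f′ = contradiction f′ (forward-exclusive f)

  backward⇒dir : ∀ {y} → Forward (inv Γ y) → dir y ≡ false
  backward⇒dir {y} f with orient y
  ... | inj₁ f′ = contradiction f (forward-exclusive f′)
  ... | inj₂ _  = refl

  dir-fD : ∀ {g} → G ∋ g → ∀ y → dir (fD g y) ≡ dir y
  dir-fD {g} g∈ y with orient y
  ... | inj₁ (h , h∈ , e) = forward⇒dir (g ∘A h , ∘∈ G g∈ h∈ , cong (fD g) e)
  ... | inj₂ (h , h∈ , e) = backward⇒dir (g ∘A h , ∘∈ G g∈ h∈ , trans (cong (fD g) e) (sym (inv-comm g y)))

  dir-inv : ∀ y → dir (inv Γ y) ≡ not (dir y)
  dir-inv y with orient y
  ... | inj₁ (h , h∈ , e) = backward⇒dir (h , h∈ , trans e (sym (inv-invol Γ y)))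
  ... | inj₂ f            = forward⇒dir f

  dir≡⇒orbit : ∀ x y → dir x ≡ dir y → ∃[ g ] (G ∋ g × fD g x ≡ y)
  dir≡⇒orbit x y e with orient x | orient y
  dir≡⇒orbit x y e | inj₁ (g , g∈ , gx) | inj₁ (h , h∈ , hy) =
    h ∘A (g ⁻¹A) , ∘∈ G h∈ (⁻¹∈ G g∈) , trans (cong (fD h) (trans (cong (fD⁻ g) (sym gx)) (fD-l g x₀))) hy
  -- Two backward darts: their inverses lie in the orbit of `x₀`, and an element matching the
  -- inverses matches the darts.
  dir≡⇒orbit x y e | inj₂ (g , g∈ , gx) | inj₂ (h , h∈ , hy) =
    k , ∘∈ G h∈ (⁻¹∈ G g∈) ,
    trans (sym (inv-invol Γ _)) (trans (cong (inv Γ) (inv-comm k x))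
      (trans (cong (inv Γ) (trans (cong (fD h) (trans (cong (fD⁻ g) (sym gx)) (fD-l g x₀))) hy)) (inv-invol Γ y)))
    where k = h ∘A (g ⁻¹A)

  -- Each vertex is the origin of two darts of each orbit.

  private
    _has_ : Fin d → Bool → Bool
    x has b = does (dir x Bool.≟ b)

    at : Bool → Fin (suc m) → Fin d → Bool
    at b v x = x has b ∧ does (beg Γ x ≟ v)

    degree : Bool → Fin (suc m) → ℕ
    degree b v = count (at b v)

    at-true : ∀ {b v x} → dir x ≡ b → beg Γ x ≡ v → at b v x ≡ true
    at-true {b} {v} {x} e f = cong₂ _∧_ (dec-true (dir x Bool.≟ b) e) (dec-true (beg Γ x ≟ v) f)

    degree-sum : ∀ v → degree true v + degree false v ≡ 4
    degree-sum v = begin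
      degree true v + degree false v
        ≡⟨ sym (∑-distrib-+ +-0-commutativeMonoid (indicator ∘ at true v) (indicator ∘ at false v)) ⟩
      ∑ (λ x → indicator (at true v x) + indicator (at false v x))
        ≡⟨ sum-cong-≗ +-0-commutativeMonoid (λ x → split (dir x) (does (beg Γ x ≟ v))) ⟩
      count (λ x → does (beg Γ x ≟ v))
        ≡⟨ sym (length-filter-tabulate (λ x → beg Γ x ≟ v) (λ x → x)) ⟩
      valence Γ v
        ≡⟨ tetra v ⟩
      4 ∎
      where
      open ≡-Reasoning
      split : ∀ b q → indicator (does (b Bool.≟ true) ∧ q) + indicator (does (b Bool.≟ false) ∧ q) ≡ indicator q
      split true  q = +-identityʳ _
      split false q = refl

    -- An element of `G` carrying `u` to `v` permutes the darts and preserves `dir`.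
    degree-const : ∀ b u v → degree b u ≡ degree b v
    degree-const b u v with vertexTransitive u v
    ... | g , g∈ , refl = sym (trans
      (sum-permute +-0-commutativeMonoid (indicator ∘ at b (fV g u)) (permutation (fD g) (fD⁻ g) (fD-r g) (fD-l g)))
      (sum-cong-≗ +-0-commutativeMonoid λ x → cong indicator (cong₂ _∧_
        (cong (λ c → does (c Bool.≟ b)) (dir-fD g∈ x))
        (does-⇔ (mk⇔ (λ e → fV-injective g (trans (sym (beg-comm g x)) e))
                     (λ e → trans (beg-comm g x) (cong (fV g) e))) (_ ≟ _) (_ ≟ _)))))

    -- Double counting: every dart has exactly one origin.
    degree-total : ∀ b → ∑ (degree b) ≡ count (_has b)
    degree-total b = trans (∑-comm +-0-commutativeMonoid (λ v x → indicator (at b v x)))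
      (sum-cong-≗ +-0-commutativeMonoid (λ x → count-∧-≟ (x has b) (beg Γ x)))

    forward≡backward : count (_has true) ≡ count (_has false)
    forward≡backward = trans
      (sum-permute +-0-commutativeMonoid (indicator ∘ (_has true))
        (permutation (inv Γ) (inv Γ) (inv-invol Γ) (inv-invol Γ)))
      (sum-cong-≗ +-0-commutativeMonoid λ x →
        cong indicator (trans (cong (λ c → does (c Bool.≟ true)) (dir-inv x)) (flip (dir x))))
      where
      flip : ∀ b → does (not b Bool.≟ true) ≡ does (b Bool.≟ false)
      flip true  = refl
      flip false = refl

    ∑-degree : ∀ b v → ∑ (degree b) ≡ suc m * degree b v
    ∑-degree b v = trans (sum-cong-≗ +-0-commutativeMonoid (λ u → degree-const b u v)) (∑-const (suc m) (degree b v))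

    -- Both degrees are constant, and their sums over the vertices agree because `inv` exchanges the
    -- two directions. The number of vertices is positive and cancels.
    degree-balanced : ∀ v → degree true v ≡ degree false v
    degree-balanced v = *-cancelˡ-≡ _ _ (suc m) (begin
      suc m * degree true v  ≡⟨ sym (∑-degree true v) ⟩
      ∑ (degree true)        ≡⟨ degree-total true ⟩
      count (_has true)      ≡⟨ forward≡backward ⟩
      count (_has false)     ≡⟨ sym (degree-total false) ⟩
      ∑ (degree false)       ≡⟨ ∑-degree false v ⟩
      suc m * degree false v ∎)
      where open ≡-Reasoning

    degree≡2 : ∀ b v → degree b v ≡ 2
    degree≡2 b v = *-cancelˡ-≡ _ 2 2 (trans (cong (degree b v +_) (+-identityʳ _)) (doubled b))
      where
      doubled : ∀ b → degree b v + degree b v ≡ 4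
      doubled true  = trans (cong (degree true v +_) (degree-balanced v)) (degree-sum v)
      doubled false = trans (cong (_+ degree false v) (sym (degree-balanced v))) (degree-sum v)

  -- Vertex stabilisers acting on the two darts of one direction.

  infix 4 _∥_
  _∥_ : Fin d → Fin d → Set
  x ∥ y = beg Γ x ≡ beg Γ y × dir x ≡ dir y

  -- By `degree≡2` every `∥`-class consists of two darts.
  ∥-pigeonhole : ∀ {a b c} → a ∥ c → b ∥ c → a ≢ b → b ≢ c → a ≡ c
  ∥-pigeonhole {c = c} (ac , ac′) (bc , bc′) =
    count≡2⇒pigeonhole (at (dir c) (beg Γ c)) (degree≡2 _ _)
      (at-true ac′ ac) (at-true bc′ bc) (at-true {x = c} refl refl)

  fixes⇒∥ : ∀ {g x} → G ∋ g → fV g (beg Γ x) ≡ beg Γ x → fD g x ∥ x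
  fixes⇒∥ {g} {x} g∈ e = trans (beg-comm g x) e , dir-fD g∈ x

  -- `g` permutes the two darts of the class, so if it fixes one it fixes the other.
  fixes-∥ : ∀ {g x z} → G ∋ g → fD g x ≡ x → z ∥ x → fD g z ≡ z
  fixes-∥ {g} {x} {z} g∈ gx (e , e′) = decidable-stable (fD g z ≟ z) λ gz≢z →
    let z≢x : z ≢ x
        z≢x = λ { refl → gz≢z gx }
        gz∥x = trans (beg-comm g z) (trans (cong (fV g) e) (fixes-beg g gx)) , trans (dir-fD g∈ z) e′
    in z≢x (fD-injective g (trans (∥-pigeonhole gz∥x (e , e′) gz≢z z≢x) (sym gx)))

  -- Both `g` and `h` exchange `x` with the only other dart of its class.
  swap-swap : ∀ {g h x} → G ∋ g → G ∋ h → fV g (beg Γ x) ≡ beg Γ x → fV h (beg Γ x) ≡ beg Γ x →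
    fD g x ≢ x → fD h x ≢ x → fD g (fD h x) ≡ x
  swap-swap {g} {h} {x} g∈ h∈ gv hv gx hx = ∥-pigeonhole
    (fixes⇒∥ (∘∈ G g∈ h∈) (trans (cong (fV g) hv) gv)) hx∥x
    (λ e → gx (fixes-∥ g∈ e (sym (proj₁ hx∥x) , sym (proj₂ hx∥x)))) hx
    where hx∥x = fixes⇒∥ h∈ hv

  square-fixes : ∀ {g x} → G ∋ g → fV g (beg Γ x) ≡ beg Γ x → fD g (fD g x) ≡ x
  square-fixes {g} {x} g∈ gv with fD g x ≟ x
  ... | yes gx = trans (cong (fD g) gx) gx
  ... | no  gx = swap-swap g∈ g∈ gv gv gx gx

  dart-at : ∀ x v → ∃[ y ] (beg Γ y ≡ v × dir y ≡ dir x)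
  dart-at x v with vertexTransitive (beg Γ x) v
  ... | g , g∈ , refl = fD g x , beg-comm g x , dir-fD g∈ x

  -- Every vertex is the origin of some dart.
  darts⇒≈ : ∀ {g h : Aut Γ} → (∀ x → fD g x ≡ fD h x) → g ≈ h
  darts⇒≈ {g} {h} e = vertices , e
    where
    vertices : ∀ v → fV g v ≡ fV h v
    vertices v with dart-at x₀ v
    ... | y , refl , _ = trans (sym (beg-comm g y)) (trans (cong (beg Γ) (e y)) (beg-comm h y))

  -- The permutation of the `M`-orbits induced by following darts.

  module Rotation (M : Subgroup Γ) (M≤G : M ≤G G) (M⊴G : M ⊴ G)
    {x} {n} (n∈ : M ∋ n) (nv : fV n (beg Γ x) ≡ beg Γ x) (nx : fD n x ≢ x) where

    infix 4 _~_
    _~_ : Fin (suc m) → Fin (suc m) → Set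
    _~_ = Orb M

    ~-map : ∀ {g u v} → G ∋ g → u ~ v → fV g u ~ fV g v
    ~-map = Orb-map G M M≤G M⊴G

    -- Some `h` in `M` brings the origin of `y` to that of `z`. If `h y` is not `z`, it is the other
    -- dart of the class of `z`, and the conjugate `c` of `n` that swaps this class corrects it
    -- within `M`.
    end-~ : ∀ {y z} → dir y ≡ dir x → dir z ≡ dir x → beg Γ y ~ beg Γ z → end Γ y ~ end Γ z
    end-~ {y} {z} y-dir z-dir o k = o λ { (h , h∈ , hv) → moved h h∈ hv (fD h y ≟ z) }
      where
      moved : ∀ h → M ∋ h → fV h (beg Γ y) ≡ beg Γ z → Dec (fD h y ≡ z) → ⊥
      moved h h∈ hv (yes refl) = k (h , h∈ , sym (end-comm h y))
      moved h h∈ hv (no hy≢z) with dir≡⇒orbit x z (sym z-dir)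
      ... | g , g∈ , refl = k ((c ⁻¹A) ∘A h , ∘∈ M (⁻¹∈ M c∈) h∈ ,
        trans (sym (end-comm ((c ⁻¹A) ∘A h) y))
              (cong (end Γ) (trans (cong (fD⁻ c) (sym cz≡hy)) (fD-l c (fD g x)))))
        where
        c : Aut Γ
        c = ((g ⁻¹A) ⁻¹A) ∘A (n ∘A (g ⁻¹A))

        c∈ : M ∋ c
        c∈ = M⊴G (g ⁻¹A) n (⁻¹∈ G g∈) n∈

        cz : fD c (fD g x) ≡ fD g (fD n x)
        cz = cong (fD g ∘ fD n) (fD-l g x)

        cv : fV c (beg Γ (fD g x)) ≡ beg Γ (fD g x)
        cv = trans (cong (fV g ∘ fV n) (trans (cong (fV⁻ g) (beg-comm g x)) (fV-l g _)))
                   (trans (cong (fV g) nv) (sym (beg-comm g x)))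

        z∥hy : fD g x ∥ fD h y
        z∥hy = trans (sym hv) (sym (beg-comm h y)) , trans z-dir (trans (sym y-dir) (sym (dir-fD (M≤G h h∈) y)))

        cz∥z : fD c (fD g x) ∥ fD g x
        cz∥z = fixes⇒∥ (M≤G c c∈) cv

        cz≡hy : fD c (fD g x) ≡ fD h y
        cz≡hy = ∥-pigeonhole (trans (proj₁ cz∥z) (proj₁ z∥hy) , trans (proj₂ cz∥z) (proj₂ z∥hy)) z∥hy
          (λ e → nx (fD-injective g (trans (sym cz) e))) (hy≢z ∘ sym)

    -- As a map on vertices this depends on the dart chosen at `u`; by `end-~` the `M`-orbit of the
    -- result does not.
    next : Fin (suc m) → Fin (suc m)
    next u = end Γ (proj₁ (dart-at x u))

    next-~ : ∀ {y u} → dir y ≡ dir x → beg Γ y ~ u → end Γ y ~ next u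
    next-~ {y} {u} y-dir o with dart-at x u
    ... | z , refl , z-dir = end-~ y-dir z-dir o

    next-cong : ∀ {u v} → u ~ v → next u ~ next v
    next-cong {u} o with dart-at x u
    ... | z , refl , z-dir = next-~ z-dir o

    next-fV : ∀ {g} → G ∋ g → ∀ u → fV g (next u) ~ next (fV g u)
    next-fV {g} g∈ u with dart-at x u
    ... | z , refl , z-dir = Orb-trans M (Orb-reflexive M (sym (end-comm g z)))
      (next-~ (trans (dir-fD g∈ z) z-dir) (Orb-reflexive M (beg-comm g z)))

    next^ : ℕ → Fin (suc m) → Fin (suc m)
    next^ zero    u = u
    next^ (suc k) u = next (next^ k u)

    next^-+ : ∀ i j u → next^ (i + j) u ≡ next^ i (next^ j u)
    next^-+ zero    j u = refl
    next^-+ (suc i) j u = cong next (next^-+ i j u)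

    next^-comm : ∀ i j u → next^ i (next^ j u) ≡ next^ j (next^ i u)
    next^-comm i j u = trans (sym (next^-+ i j u)) (trans (cong (λ k → next^ k u) (+-comm i j)) (next^-+ j i u))

    next^-cong : ∀ k {u v} → u ~ v → next^ k u ~ next^ k v
    next^-cong zero    o = o
    next^-cong (suc k) o = next-cong (next^-cong k o)

    next^-fV : ∀ {g} → G ∋ g → ∀ k u → fV g (next^ k u) ~ next^ k (fV g u)
    next^-fV g∈ zero    u = Orb-refl M
    next^-fV g∈ (suc k) u = Orb-trans M (next-fV g∈ (next^ k u)) (next-cong (next^-fV g∈ k u))

    ^A-next : ∀ {h u} → G ∋ h → fV h u ≡ next u → ∀ k → fV (h ^A k) u ~ next^ k u
    ^A-next         h∈ e zero    = Orb-refl M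
    ^A-next {h} {u} h∈ e (suc k) = Orb-trans M (~-map h∈ (^A-next h∈ e k))
      (Orb-trans M (next^-fV h∈ k u) (Orb-reflexive M (trans (cong (next^ k) e) (next^-comm k 1 u))))

    -- An element of G moving a vertex u to next u acts on it like next, up to M,
    -- and some power of it fixes u.
    next-period : ∃[ q ] (∀ u → next^ (suc q) u ~ u)
    next-period with vertexTransitive (beg Γ x) (next (beg Γ x))
    ... | h , h∈ , hv with pigeonhole (n<1+n (suc m)) (λ i → fV (h ^A toℕ i) (beg Γ x))
    -- `i<j` unfolds to `suc (toℕ i) ≤ toℕ j`, so the difference of the exponents is `suc q`, a
    -- positive period.
    ... | i , j , i<j , e with m≤n⇒∃[o]m+o≡n i<j
    ... | q , q-eq = q , everywhere
      where
      i+1+q : toℕ i + suc q ≡ toℕ j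
      i+1+q = trans (+-suc (toℕ i) q) q-eq

      returns : fV (h ^A suc q) (beg Γ x) ≡ beg Γ x
      returns = fV-injective (h ^A toℕ i) (sym (trans e
        (trans (cong (λ k → fV (h ^A k) (beg Γ x)) (sym i+1+q)) (fV-^A-+ h (toℕ i) (suc q) (beg Γ x)))))

      everywhere : ∀ u → next^ (suc q) u ~ u
      everywhere u with vertexTransitive (beg Γ x) u
      ... | g , g∈ , refl = Orb-trans M (Orb-sym M (next^-fV g∈ (suc q) (beg Γ x)))
        (~-map g∈ (Orb-trans M (Orb-sym M (^A-next h∈ hv (suc q))) (Orb-reflexive M returns)))

    -- A step along a dart with the direction of `x` applies `next`; any other step applies its
    -- inverse, which the period turns into a power of `next`.
    walk⇒next^ : ∀ {u v} → Walk Γ u v → ∃[ k ] (v ~ next^ k u)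
    walk⇒next^ here = 0 , Orb-refl M
    walk⇒next^ (step y refl w) with walk⇒next^ w | dir y Bool.≟ dir x
    ... | k , o | yes y-dir = k + 1 , Orb-trans M o (Orb-trans M (next^-cong k (next-~ y-dir (Orb-refl M)))
      (Orb-reflexive M (sym (next^-+ k 1 (beg Γ y)))))
    ... | k , o | no ¬y-dir = k + proj₁ next-period , Orb-trans M o (Orb-trans M (next^-cong k back)
      (Orb-reflexive M (sym (next^-+ k _ (beg Γ y)))))
      where
      inv-dir : dir (inv Γ y) ≡ dir x
      inv-dir = trans (dir-inv y) (sym (Bool.¬-not (¬y-dir ∘ sym)))

      -- `next` leads from the end of `y` back to its origin, and one less than the period many
      -- further applications complete the cycle.
      back : end Γ y ~ next^ (proj₁ next-period) (beg Γ y)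
      back = Orb-trans M (Orb-sym M (proj₂ next-period (end Γ y)))
        (Orb-trans M (Orb-reflexive M (next^-comm 1 (proj₁ next-period) (end Γ y)))
          (next^-cong (proj₁ next-period) (Orb-sym M
            (Orb-trans M (Orb-reflexive M (cong (beg Γ) (sym (inv-invol Γ y))))
                         (next-~ inv-dir (Orb-refl M))))))

    module _ (connected : Connected Γ) where

      -- On the orbit of `v`, both `g` and `h` act as powers of `next`. These powers commute with
      -- each other and, by `next^-fV`, with `G`.
      commutator-~ : ∀ {g h} → G ∋ g → G ∋ h → ∀ v → fV g (fV h v) ~ fV h (fV g v)
      commutator-~ {g} {h} g∈ h∈ v with walk⇒next^ (connected v (fV g v)) | walk⇒next^ (connected v (fV h v))
      ... | i , gv | j , hv = Orb-trans M (half-way g∈ j i hv gv) (Orb-trans M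
        (Orb-reflexive M (next^-comm j i v)) (Orb-sym M (half-way h∈ i j gv hv)))
        where
        half-way : ∀ {g w} → G ∋ g → ∀ j i → w ~ next^ j v → fV g v ~ next^ i v →
          fV g w ~ next^ j (next^ i v)
        half-way g∈ j i w gv = Orb-trans M (~-map g∈ w) (Orb-trans M (next^-fV g∈ j v) (next^-cong j gv))

      comm∈Ker : ∀ {g h} → G ∋ g → G ∋ h → Ker G M M≤G M⊴G ∋ comm g h
      comm∈Ker {g} {h} g∈ h∈ =
        ∘∈ G (⁻¹∈ G g∈) (∘∈ G (⁻¹∈ G h∈) (∘∈ G g∈ h∈)) ,
        λ v → Orb-sym M (Orb-trans M
          (~-map (⁻¹∈ G g∈) (~-map (⁻¹∈ G h∈) (commutator-~ g∈ h∈ v)))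
          (Orb-reflexive M (trans (cong (fV⁻ g) (fV-l h _)) (fV-l g v))))

      -- `g` commutes with the transitive action of `next` on orbits and fixes the orbit of `v`,
      -- hence fixes all orbits.
      stab≤Ker : ∀ {g v} → stab G v g → Ker G M M≤G M⊴G ∋ g
      stab≤Ker {g} {v} (g∈ , gv) = g∈ , λ u → let (k , o) = walk⇒next^ (connected v u) in
        Orb-trans M o (Orb-sym M (Orb-trans M (~-map g∈ o)
          (Orb-trans M (next^-fV g∈ k v) (Orb-reflexive M (cong (next^ k) gv)))))

  -- The groups `K`, `M` and `L` attached to an abelian normal subgroup.

  module AbelianNormal (connected : Connected Γ)
    (N : Subgroup Γ) (N≤G : N ≤G G) (N⊴G : N ⊴ G) (abelian : Abelian N) where

    K : Subgroup Γ
    K = Ker G N N≤G N⊴G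

    -- At `v`, `k` agrees with some `m` in `N`, and `n` commutes with `m`.
    N-fixes-vertex : ∀ {n k v} → N ∋ n → K ∋ k → fV n v ≡ v → fV n (fV k v) ≡ fV k v
    N-fixes-vertex {n} {k} {v} n∈ (_ , o) nv = decidable-stable (_ ≟ _) λ ¬e → o v λ { (m , m∈ , mv) →
      ¬e (subst (λ w → fV n w ≡ w) mv (trans (proj₁ (abelian n m n∈ m∈) v) (cong (fV m) nv))) }

    -- Some `m` in `N` agrees with `k` at the origin of `y`. Then `n` fixes `m y` by commutation,
    -- and so also `k y`, which has the same origin and direction.
    N-fixes-dart : ∀ {n k y} → N ∋ n → K ∋ k → fD n y ≡ y → fD n (fD k y) ≡ fD k y
    N-fixes-dart {n} {k} {y} n∈ (k∈ , o) ny = decidable-stable (_ ≟ _) λ ¬e → o (beg Γ y) λ { (m , m∈ , mv) →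
      ¬e (fixes-∥ (N≤G n n∈) (trans (proj₂ (abelian n m n∈ m∈) y) (cong (fD m) ny))
        (trans (beg-comm k y) (trans (sym mv) (sym (beg-comm m y))) ,
         trans (dir-fD k∈ y) (sym (dir-fD (N≤G m m∈) y)))) }

    -- Both conditions are stated on darts alone, which determine an automorphism by `darts⇒≈`.
    M : Subgroup Γ
    M ._∈_ h = N ∋ h × (∀ y → fD h (fD h y) ≡ y) × (∀ {k} → K ∋ k → ∀ y → fD h (fD k y) ≡ fD k (fD h y))
    M .∈-resp {g} {h} g≈h@(_ , e) (g∈ , sq , cen) =
      ∈-resp N g≈h g∈ ,
      (λ y → trans (sym (trans (cong (fD g) (e y)) (e _))) (sq y)) ,
      (λ {k} k∈ y → trans (sym (e _)) (trans (cen k∈ y) (cong (fD k) (e y))))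
    M .id∈ = id∈ N , (λ y → refl) , (λ k∈ y → refl)
    M .∘∈ {g} {h} (g∈ , gsq , gcen) (h∈ , hsq , hcen) =
      ∘∈ N g∈ h∈ ,
      (λ y → trans (cong (fD g) (proj₂ (abelian h g h∈ g∈) (fD h y))) (trans (gsq _) (hsq y))) ,
      (λ k∈ y → trans (cong (fD g) (hcen k∈ y)) (gcen k∈ (fD h y)))
    M .⁻¹∈ {g} (g∈ , sq , cen) =
      ⁻¹∈ N g∈ ,
      (λ y → trans (cong (fD⁻ g ∘ fD⁻ g) (sym (sq y))) (trans (cong (fD⁻ g) (fD-l g _)) (fD-l g y))) ,
      (λ {k} k∈ y → trans (cong (fD⁻ g ∘ fD k) (sym (fD-r g y)))
        (trans (cong (fD⁻ g) (sym (cen k∈ (fD⁻ g y)))) (fD-l g _)))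

    M≤G : M ≤G G
    M≤G h (h∈ , _) = N≤G h h∈

    -- `G` normalises `K`, hence also the centraliser of `K`.
    M⊴G : M ⊴ G
    M⊴G g h g∈ (h∈ , sq , cen) =
      N⊴G g h g∈ h∈ ,
      (λ y → trans (cong (fD⁻ g ∘ fD h) (fD-r g _)) (trans (cong (fD⁻ g) (sq _)) (fD-l g y))) ,
      (λ {k} k∈ y → trans (cong (fD⁻ g ∘ fD h ∘ fD g ∘ fD k) (sym (fD-l g y)))
        (trans (cong (fD⁻ g) (cen (Ker-normal G N N≤G N⊴G (g ⁻¹A) k (⁻¹∈ G g∈) k∈) (fD g y)))
          (fD-l g _)))

    L : Subgroup Γ
    L = Ker G M M≤G M⊴G

    L≤K : L ≤G K
    L≤K g (g∈ , o) = g∈ , λ v k → o v λ { (m , m∈ , e) → k (m , proj₁ m∈ , e) }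

    L-exponent-2 : ∀ g → L ∋ g → (g ∘A g) ≈ idA
    L-exponent-2 g g∈L@(g∈ , o) = darts⇒≈ {g = g ∘A g} {h = idA} λ y →
      decidable-stable (_ ≟ _) λ ¬e → o (beg Γ y) λ { (m , m∈@(_ , sq , cen) , mv) → ¬e
        (let h = (m ⁻¹A) ∘A g
             hh : fD h (fD h y) ≡ y
             hh = square-fixes {g = h} (∘∈ G (⁻¹∈ G (M≤G m m∈)) g∈)
                    (trans (cong (fV⁻ m) (sym mv)) (fV-l m _))
             mhy : fD g y ≡ fD m (fD h y)
             mhy = sym (fD-r m _)
             mhh : fD g (fD h y) ≡ fD m (fD h (fD h y))
             mhh = sym (fD-r m _)
         -- With `g = m h` and `m` commuting with `g`, which lies in `K`: `g g y = g m h y = m g h y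
         -- = m m h h y = y`.
         in trans (cong (fD g) mhy) (trans (sym (cen (L≤K g g∈L) (fD h y)))
              (trans (cong (fD m) mhh) (trans (sq _) hh)))) }

    -- Elements of `N` that fix a vertex and move the fewest darts.

    moved : Aut Γ → ℕ
    moved n = count (λ y → not (does (fD n y ≟ y)))

    moved-< : ∀ n n′ {x} → (∀ y → fD n y ≡ y → fD n′ y ≡ y) →
      fD n′ x ≡ x → fD n x ≢ x → moved n′ < moved n
    moved-< n n′ {x} more n′x nx = count-mono-< mono x
      (cong not (dec-true (_ ≟ _) n′x)) (cong not (dec-false (_ ≟ _) nx))
      where
      mono : ∀ y → not (does (fD n′ y ≟ y)) ≡ true → not (does (fD n y ≟ y)) ≡ true
      mono y with fD n y ≟ y
      ... | no  _  = λ _ → refl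
      ... | yes ny rewrite dec-true (fD n′ y ≟ y) (more y ny) = λ ()

    Fixing : Aut Γ → Set
    Fixing n = N ∋ n × (∃[ v ] fV n v ≡ v) × ¬ (n ≈ idA)

    -- Otherwise `n` fixes every dart at each vertex it fixes, hence the ends of those darts, and
    -- along walks from `v` it fixes the whole graph.
    moves-dart : ∀ {n v} → fV n v ≡ v → ¬ (n ≈ idA) → ¬ ¬ (∃[ x ] (fV n (beg Γ x) ≡ beg Γ x × fD n x ≢ x))
    moves-dart {n} {v} nv n≉id none = n≉id (darts⇒≈ {g = n} {h = idA} λ x →
      fixed-dart x (fixed-vertex (connected v (beg Γ x)) nv))
      where
      fixed-dart : ∀ x → fV n (beg Γ x) ≡ beg Γ x → fD n x ≡ x
      fixed-dart x e = decidable-stable (_ ≟ _) λ nx → none (x , e , nx)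

      fixed-vertex : ∀ {u w} → Walk Γ u w → fV n u ≡ u → fV n w ≡ w
      fixed-vertex here            e = e
      fixed-vertex (step y refl w) e =
        fixed-vertex w (trans (sym (end-comm n y)) (cong (end Γ) (fixed-dart y e)))

    minimal∈M : ∀ {n x} → Fixing n → (∀ n′ → Fixing n′ → ¬ (moved n′ < moved n)) →
      fV n (beg Γ x) ≡ beg Γ x → fD n x ≢ x → M ∋ n
    minimal∈M {n} {x} (n∈ , (v , nv) , _) minimal nbx nx = n∈ , square , central
      where
      trivial : ∀ n′ → N ∋ n′ → fV n′ v ≡ v →
        (∀ y → fD n y ≡ y → fD n′ y ≡ y) → fD n′ x ≡ x → ∀ y → fD n′ y ≡ y
      trivial n′ n′∈ n′v more n′x y = decidable-stable (_ ≟ _) λ n′y →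
        minimal n′ (n′∈ , (v , n′v) , λ e → n′y (proj₂ e y)) (moved-< n n′ more n′x nx)

      square : ∀ y → fD n (fD n y) ≡ y
      square = trivial (n ∘A n) (∘∈ N n∈ n∈) (trans (cong (fV n) nv) nv)
        (λ y ny → trans (cong (fD n) ny) ny) (square-fixes (N≤G n n∈) nbx)

      central : ∀ {k} → K ∋ k → ∀ y → fD n (fD k y) ≡ fD k (fD n y)
      -- From `nᵏ n = 1` and `n n = 1`: `n k y = n k n n y = k nᵏ n n y = k n y`.
      central {k} k∈ y = trans (cong (fD n ∘ fD k) (sym (square y)))
        (trans (sym (fD-r k _)) (cong (fD k) (c-trivial (fD n y))))
        where
        nᵏ : Aut Γ
        nᵏ = (k ⁻¹A) ∘A (n ∘A k)

        nᵏ∈ : N ∋ nᵏ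
        nᵏ∈ = N⊴G k n (proj₁ k∈) n∈

        nᵏ-vertex : ∀ {u} → fV n u ≡ u → fV nᵏ u ≡ u
        nᵏ-vertex nu = trans (cong (fV⁻ k) (N-fixes-vertex n∈ k∈ nu)) (fV-l k _)

        nᵏx : fD nᵏ x ≢ x
        -- If `nᵏ` fixed `x`, then `n` would fix `k x`, and so `x` itself, since the inverse of `k`
        -- is in `K` too.
        nᵏx e = nx (subst (λ z → fD n z ≡ z) (fD-l k x)
          (N-fixes-dart n∈ (⁻¹∈ K {k} k∈) (trans (sym (fD-r k _)) (cong (fD k) e))))

        c-trivial : ∀ y → fD nᵏ (fD n y) ≡ y
        c-trivial = trivial (nᵏ ∘A n) (∘∈ N nᵏ∈ n∈) (trans (cong (fV nᵏ) nv) (nᵏ-vertex nv))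
          (λ y ny → trans (cong (fD nᵏ) ny) (trans (cong (fD⁻ k) (N-fixes-dart n∈ k∈ ny)) (fD-l k y)))
          (swap-swap (N≤G nᵏ nᵏ∈) (N≤G n n∈) (nᵏ-vertex nbx) nbx nᵏx nx)

    -- Solvability of `G` and the structure of its vertex stabilisers.

    module _ (nontrivial : ∃[ v ] ∃[ g ] (stab N v g × ¬ (g ≈ idA))) where

      -- The double negation comes from the choice of a minimal element. It is harmless, because the
      -- orbit condition defining `L` is itself a negation.
      swapping : ¬ ¬ (∃[ x ] ∃[ n ] (M ∋ n × fV n (beg Γ x) ≡ beg Γ x × fD n x ≢ x))
      swapping none = let (v , g , (g∈ , gv) , g≉id) = nontrivial in
        ¬¬-minimum {P = Fixing} moved (g∈ , (v , gv) , g≉id)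
        λ { (n , fix@(_ , (_ , nv) , n≉id) , minimal) → moves-dart {n} nv n≉id
          λ { (x , nbx , nx) → none (x , n , minimal∈M fix minimal nbx nx , nbx , nx) } }

      G-comm : ∀ g h → G ∋ g → G ∋ h → L ∋ comm g h
      G-comm g h g∈ h∈ =
        ∘∈ G (⁻¹∈ G g∈) (∘∈ G (⁻¹∈ G h∈) (∘∈ G g∈ h∈)) ,
        λ v k → swapping λ { (x , n , n∈ , nbx , nx) →
          proj₂ (Rotation.comm∈Ker M M≤G M⊴G n∈ nbx nx connected g∈ h∈) v k }

      stab≤L : ∀ {v g} → stab G v g → L ∋ g
      stab≤L gv@(g∈ , _) = g∈ , λ u k → swapping λ { (x , n , n∈ , nbx , nx) →
        proj₂ (Rotation.stab≤Ker M M≤G M⊴G n∈ nbx nx connected gv) u k }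

      L-abelian : Abelian L
      L-abelian = exponent-2⇒abelian L L-exponent-2

      stab-elementary : ∀ v → ElementaryAbelian (stab G v)
      stab-elementary v =
        (λ g h g∈ h∈ → L-abelian g h (stab≤L g∈) (stab≤L h∈)) ,
        2 , prime[2] , λ g g∈ → L-exponent-2 g (stab≤L g∈)

      solvable : Solvable G
      solvable = 2 , S , (λ g → (λ g∈ → g∈) , (λ g∈ → g∈)) , (λ g g∈ → g∈) , steps
        where
        S : Fin 3 → Subgroup Γ
        S zero             = G
        S (suc zero)       = L
        S (suc (suc zero)) = trivialSubgroup

        steps : ∀ (i : Fin 2) → (S (suc i) ≤G S (inject₁ i)) × (S (suc i) ⊴ S (inject₁ i)) ×
          (∀ g h → S (inject₁ i) ∋ g → S (inject₁ i) ∋ h → S (suc i) ∋ comm g h)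
        steps zero = (λ g → proj₁) , Ker-normal G M M≤G M⊴G , G-comm
        steps (suc zero) =
          (λ g g∈ → ∈-resp L ((λ u → sym (proj₁ g∈ u)) , (λ x → sym (proj₂ g∈ x))) (id∈ L)) ,
          (λ g h _ h∈ → (λ u → trans (cong (fV⁻ g) (proj₁ h∈ _)) (fV-l g u)) ,
                        (λ x → trans (cong (fD⁻ g) (proj₂ h∈ _)) (fD-l g x))) ,
          λ g h g∈ h∈ → let (e , f) = L-abelian g h g∈ h∈ in
            (λ u → trans (cong (fV⁻ g ∘ fV⁻ h) (e u)) (trans (cong (fV⁻ g) (fV-l h _)) (fV-l g u))) ,
            (λ x → trans (cong (fD⁻ g ∘ fD⁻ h) (f x)) (trans (cong (fD⁻ g) (fD-l h _)) (fD-l g x)))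

theorem3p1 : ∀ {d m} (Γ : Graph d (suc m)) → Connected Γ → Tetravalent Γ →
    (G : Subgroup Γ) → HalfArcTransitive G →
    (N : Subgroup Γ) → N ≤G G → N ⊴ G → Abelian N →
    (∃[ v ] ∃[ g ] (stab N v g × ¬ (g ≈ idA))) →
    Solvable G × (∀ v → ElementaryAbelian (stab G v))
theorem3p1 Γ connected tetra G half N N≤G N⊴G abelian nontrivial =
  solvable nontrivial , stab-elementary nontrivial
  where open HalfTransitive.AbelianNormal Γ tetra G half connected N N≤G N⊴G abelian
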